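{- Let $m=3^k$ with $k\in\mathbb{N}$, $k\geq1$. Then there exists an integer $a$ with $1\leq a<m$ and $\gcd(a,3)=1$ such that $K_{\mathbb{C}}(a/m)\leq 8$.
   Context: For $z\in\mathbb{C}$, $[z]:=\lfloor \mathrm{Re}(z)+\tfrac12\rfloor+i\lfloor \mathrm{Im}(z)+\tfrac12\rfloor$. Let $\mathfrak{F}=\{z\in\mathbb{C}: -\tfrac12\leq\mathrm{Re}(z)<\tfrac12,\ -\tfrac12\leq\mathrm{Im}(z)<\tfrac12\}$ and $T:\mathfrak{F}\to\mathfrak{F}$, $T(z)=z^{ -1}-[z^{ -1}]$ for $z\neq0$, $T(0)=0$. For $z\in\mathfrak{F}\setminus\{0\}$, $a_1(z)=[z^{ -1}]$ and, while $T^{n-1}(z)\neq0$, $a_n(z)=a_1(T^{n-1}(z))$. For general $z\in\mathbb{C}$, $a_0(z)=[z]$ and $a_n(z)=a_n(z-a_0(z))$ for $n\geq1$. For $z\in\mathbb{Q}(i)$ the sequence terminates, giving the Hurwitz continued fraction $[a_0(z);a_1(z),\ldots,a_n(z)]_{\mathbb{C}}$, and $K_{\mathbb{C}}(z):=\max(|a_1(z)|,\ldots,|a_n(z)|)$ (the term $a_0$ is not included). -}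

module Defs where

open import Data.Nat as ℕ using (ℕ; zero; suc)
open import Data.Integer as ℤ using (ℤ; +_)
open import Data.Rational as ℚ using (ℚ; floor; ½; 0ℚ; _+_; _-_; _*_; -_; 1/_)
open import Data.Rational.Properties using (_≟_)
open import Data.Nat.Properties using (m^n≢0)
open import Data.Rational using (≢-nonZero)
open import Data.List using (List; []; _∷_)
open import Data.Maybe using (Maybe; just; nothing; map)
open import Data.Product using (_×_; _,_)
open import Relation.Nullary using (yes; no)

record ℚi : Set where
  constructor _+i_
  field
    re : ℚ
    im : ℚ
open ℚi public

record ℤi : Set where
  constructor _+iℤ_
  field
    reℤ : ℤ
    imℤ : ℤ
open ℤi public

normℤi : ℤi → ℤ
normℤi (x +iℤ y) = x ℤ.* x ℤ.+ y ℤ.* y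

toℚi : ℤi → ℚi
toℚi (x +iℤ y) = (x ℚ./ 1) +i (y ℚ./ 1)

_-i_ : ℚi → ℚi → ℚi
(a +i b) -i (c +i d) = (a - c) +i (b - d)

⌊_⌉ : ℚi → ℤi
⌊ a +i b ⌉ = floor (a + ½) +iℤ floor (b + ½)

inv : ℚi → Maybe ℚi
inv (a +i b) with (a * a + b * b) ≟ 0ℚ
... | yes _ = nothing
... | no n≢0 = just ((a * r) +i (- (b * r)))
  where
    instance _ = ≢-nonZero n≢0
    r = 1/ (a * a + b * b)

-- Hurwitz digits of a point z of 𝔉 with at most `fuel` steps:
-- returns just [a₁, …, aₙ] if Tⁿ z = 0 is reached within fuel steps.
digits𝔉 : ℕ → ℚi → Maybe (List ℤi)
digits𝔉 fuel z with inv z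
... | nothing = just []
digits𝔉 zero z | just w = nothing
digits𝔉 (suc fuel) z | just w =
  map (⌊ w ⌉ ∷_) (digits𝔉 fuel (w -i toℚi ⌊ w ⌉))

-- For general z: a_n(z) = a_n(z - a₀(z)), n ≥ 1 (a₀ is dropped).
hurwitzDigits : ℕ → ℚi → Maybe (List ℤi)
hurwitzDigits fuel z = digits𝔉 fuel (z -i toℚi ⌊ z ⌉)

AllAbsLe : ℕ → List ℤi → Set
AllAbsLe B [] = Data.Unit.⊤ where import Data.Unit
AllAbsLe B (a ∷ as) = (normℤi a ℤ.≤ + (B ℕ.* B)) × AllAbsLe B as

-- K_ℂ(z) ≤ B for z ∈ ℚ(i): the (terminating) Hurwitz expansion
-- [a₀; a₁, …, aₙ] has max(|a₁|, …, |aₙ|) ≤ B.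
KC≤ : ℚi → ℕ → Set
KC≤ z B = Data.Product.∃ λ fuel → Data.Product.∃ λ ds →
  (hurwitzDigits fuel z Relation.Binary.PropositionalEquality.≡ just ds) × AllAbsLe B ds
  where import Relation.Binary.PropositionalEquality

_/3^_ : ℕ → ℕ → ℚ
a /3^ k = (+ a) ℚ./ (3 ℕ.^ k)
  where instance _ = m^n≢0 3 k

{-# OPTIONS --safe #-}
-- For a real point the Hurwitz algorithm is the nearest-integer continued
-- fraction, and every word of digits of absolute value at least 3 is the
-- expansion of its value.  As in Niederreiter's treatment of Zaremba's problem
-- for powers of 3, words are folded: writing K for the continuant and ũ for the
-- reversal of u,
--   K(u, c + 1, c − 1, ũ) = K(u, c)²   and   K(u, c, 3, −c, −ũ) = ± 3 K(u, c)²,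
-- so an exponent k yields 2k and 2k + 1, and 3, 4, 5 yield all k ≥ 3.  Keeping
-- the first digit 7 makes the last digit of a folded word ± 7, so that the
-- digits c ± 1 of the next fold stay within [3, 8] in absolute value.
module Submission where

open import Defs
open import Data.Nat using (ℕ; _≤_; _<_; _^_)
open import Data.Nat.GCD using (gcd)
open import Data.Rational using (0ℚ)
open import Data.Product using (∃; _×_)
open import Relation.Binary.PropositionalEquality using (_≡_)

open import Data.Nat as ℕ using (zero; suc; z≤n; s≤s)
import Data.Nat.Properties as ℕ
open import Data.Nat.Coprimality using (coprime⇒gcd≡1)
import Data.Nat.Divisibility as ℕ∣
open import Data.Nat.Induction using (<-rec)
open import Data.Integer as ℤ using (ℤ; +_; -[1+_]; ∣_∣; _+_; _*_; -_; 0ℤ; 1ℤ; -1ℤ)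
import Data.Integer.DivMod as ℤ
open import Data.Integer.Divisibility.Signed as ℤ∣ using (_∣_)
import Data.Integer.Properties as ℤ
open import Data.Integer.Tactic.RingSolver using (solve-∀)
open import Data.List using (List; []; _∷_; _++_; foldr; foldl; reverse; map; length)
open import Data.List.Properties using (foldr-++; reverse-foldr; reverse-map; unfold-reverse; ++-assoc)
open import Data.List.Relation.Binary.Permutation.Propositional using (↭-sym)
open import Data.List.Relation.Binary.Permutation.Propositional.Properties using (All-resp-↭; ↭-reverse)
open import Data.List.Relation.Unary.All as All using (All; []; _∷_; all?)
import Data.List.Relation.Unary.All.Properties as All
open import Data.Maybe as Maybe using (just)
open import Data.Product using (_,_; proj₁; proj₂)
open import Data.Rational as ℚ using (ℚ; 1ℚ; ½; floor; toℚᵘ; _/_)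
import Data.Rational.Properties as ℚ
open import Data.Rational.Solver using (module +-*-Solver)
open import Data.Rational.Unnormalised as ℚᵘ using (mkℚᵘ; *≡*; *<*)
import Data.Rational.Unnormalised.Properties as ℚᵘ
open import Data.Sum using (_⊎_; inj₁; inj₂)
open import Function using (flip)
open import Relation.Binary using (tri<; tri≈; tri>)
open import Relation.Binary.PropositionalEquality
  using (_≢_; refl; sym; trans; cong; cong₂; subst; subst₂; module ≡-Reasoning)
open import Relation.Nullary using (yes; no; contradiction)
open import Relation.Nullary.Decidable using (True; toWitness; _×-dec_)
open import Relation.Unary using (Decidable)

-- Continuants and the two folding identities.

step : ℤ → ℤ × ℤ → ℤ × ℤ
step b (p , q) = q , b * q + p

-- cont (b₁ ∷ … ∷ bₙ ∷ []) = (p , q) with p / q = 1 / (b₁ + 1 / (… + 1 / bₙ)).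
cont : List ℤ → ℤ × ℤ
cont = foldr step (0ℤ , 1ℤ)

denom : List ℤ → ℤ
denom bs = proj₂ (cont bs)

-- Euclid's algorithm run backwards: a common divisor of the pair (q, b q + p) also divides p, and
-- peeling off all digits ends at the pair (0, 1).
cont-coprime : ∀ bs {d} → d ∣ proj₁ (cont bs) → d ∣ denom bs → d ∣ 1ℤ
cont-coprime []       d∣p d∣q = d∣q
cont-coprime (b ∷ bs) d∣q d∣bq+p =
  cont-coprime bs (ℤ∣.∣m+n∣m⇒∣n d∣bq+p (ℤ∣.∣n⇒∣m*n b d∣q)) d∣q

infix 7 _∙_

_∙_ : ℤ × ℤ → ℤ × ℤ → ℤ
(p , q) ∙ (r , s) = p * r + q * s

-- The matrix of `step b` has rows (0, 1) and (1, b), so it is symmetric.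
step-selfAdjoint : ∀ b s t → step b s ∙ t ≡ s ∙ step b t
step-selfAdjoint b (p , q) (r , s) = identity b p q r s
  where
  identity : ∀ b p q r s → q * r + (b * q + p) * s ≡ p * s + q * (b * s + r)
  identity = solve-∀

-- Moving the symmetric matrices across the dot product one at a time reverses their order, hence
-- the `foldl` on the right.
foldr-adjoint : ∀ u s t → foldr step s u ∙ t ≡ s ∙ foldl (flip step) t u
foldr-adjoint []      s t = refl
foldr-adjoint (b ∷ u) s t =
  trans (step-selfAdjoint b (foldr step s u) t) (foldr-adjoint u s (step b t))

-- Euler's splitting rule for continuants. The second coordinate is the dot product with (0, 1),
-- which is also the seed of `cont`; by adjointness the prefix then acts on that seed in reverse
-- order.
denom-++ : ∀ u w → denom (u ++ w) ≡ cont w ∙ cont (reverse u)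
denom-++ u w = begin
  denom (u ++ w)                                ≡⟨ cong proj₂ (foldr-++ step _ u w) ⟩
  proj₂ (foldr step (cont w) u)                 ≡⟨ dot-0,1 (foldr step (cont w) u) ⟨
  foldr step (cont w) u ∙ (0ℤ , 1ℤ)             ≡⟨ foldr-adjoint u (cont w) _ ⟩
  cont w ∙ foldl (flip step) (0ℤ , 1ℤ) u        ≡⟨ cong (cont w ∙_) (reverse-foldr step (0ℤ , 1ℤ) u) ⟨
  cont w ∙ cont (reverse u)                     ∎
  where
  open ≡-Reasoning
  identity : ∀ p q → p * 0ℤ + q * 1ℤ ≡ q
  identity = solve-∀
  dot-0,1 : ∀ s → s ∙ (0ℤ , 1ℤ) ≡ proj₂ s
  dot-0,1 (p , q) = identity p q

-- Splitting both continuants after `u` leaves polynomials in c and (p, q) = `cont (reverse u)`.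
-- Here K(u, c) = p + c q, and the folded continuant expands to (p + c q)².
denom-square : ∀ u c → denom (u ++ (c + 1ℤ) ∷ (c + -1ℤ) ∷ reverse u) ≡
                       denom (u ++ c ∷ []) * denom (u ++ c ∷ [])
denom-square u c
  rewrite denom-++ u ((c + 1ℤ) ∷ (c + -1ℤ) ∷ reverse u) | denom-++ u (c ∷ [])
  = identity c (proj₁ (cont (reverse u))) (proj₂ (cont (reverse u)))
  where
  identity : ∀ c p q →
    ((c + -1ℤ) * q + p) * p + ((c + 1ℤ) * ((c + -1ℤ) * q + p) + q) * q ≡
    (1ℤ * p + (c * 1ℤ + 0ℤ) * q) * (1ℤ * p + (c * 1ℤ + 0ℤ) * q)
  identity = solve-∀

-- Negating all digits negates the value p / q. The sign lands on the numerator for words of even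
-- length and on the denominator for words of odd length, and each further digit switches between
-- the two.
cont-neg : ∀ bs → let (p , q) = cont bs in
  cont (map -_ bs) ≡ (- p , q) ⊎ cont (map -_ bs) ≡ (p , - q)
cont-neg []       = inj₁ refl
cont-neg (b ∷ bs) with cont (map -_ bs) | cont-neg bs
... | _ | inj₁ refl = inj₂ (cong (_ ,_) (identity b _ _))
  where
  identity : ∀ b p q → - b * q + - p ≡ - (b * q + p)
  identity = solve-∀
... | _ | inj₂ refl = inj₁ (cong (_ ,_) (identity b _ _))
  where
  identity : ∀ b p q → - b * - q + p ≡ b * q + p
  identity = solve-∀

-- The same splitting, with the negated half described by `cont-neg`. The parity of the length of
-- `u` decides the sign, which disappears once absolute values are taken.
denom-thrice-square : ∀ u c →
  let K = denom (u ++ c ∷ [])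
      K′ = denom (u ++ c ∷ + 3 ∷ - c ∷ reverse (map -_ u))
  in K′ ≡ - (+ 3 * (K * K)) ⊎ K′ ≡ + 3 * (K * K)
denom-thrice-square u c
  rewrite denom-++ u (c ∷ + 3 ∷ - c ∷ reverse (map -_ u)) | denom-++ u (c ∷ [])
        | sym (reverse-map -_ u)
  with cont (reverse u) | cont (map -_ (reverse u)) | cont-neg (reverse u)
... | p , q | _ | inj₁ refl = inj₁ (identity c p q)
  where
  identity : ∀ c p q →
    (+ 3 * (- c * q + - p) + q) * p + (c * (+ 3 * (- c * q + - p) + q) + (- c * q + - p)) * q ≡
    - (+ 3 * ((1ℤ * p + (c * 1ℤ + 0ℤ) * q) * (1ℤ * p + (c * 1ℤ + 0ℤ) * q)))
  identity = solve-∀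
... | p , q | _ | inj₂ refl = inj₂ (identity c p q)
  where
  identity : ∀ c p q →
    (+ 3 * (- c * - q + p) + - q) * p + (c * (+ 3 * (- c * - q + p) + - q) + (- c * - q + p)) * q ≡
    + 3 * ((1ℤ * p + (c * 1ℤ + 0ℤ) * q) * (1ℤ * p + (c * 1ℤ + 0ℤ) * q))
  identity = solve-∀

∣denom-square∣ : ∀ u c → ∣ denom (u ++ (c + 1ℤ) ∷ (c + -1ℤ) ∷ reverse u) ∣ ≡
                         ∣ denom (u ++ c ∷ []) ∣ ℕ.* ∣ denom (u ++ c ∷ []) ∣
∣denom-square∣ u c = trans (cong ∣_∣ (denom-square u c)) (ℤ.abs-* K K)
  where K = denom (u ++ c ∷ [])

∣3i²∣ : ∀ i → ∣ + 3 * (i * i) ∣ ≡ 3 ℕ.* (∣ i ∣ ℕ.* ∣ i ∣)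
∣3i²∣ i = trans (ℤ.abs-* (+ 3) (i * i)) (cong (3 ℕ.*_) (ℤ.abs-* i i))

∣denom-thrice-square∣ : ∀ u c → ∣ denom (u ++ c ∷ + 3 ∷ - c ∷ reverse (map -_ u)) ∣ ≡
                       3 ℕ.* (∣ denom (u ++ c ∷ []) ∣ ℕ.* ∣ denom (u ++ c ∷ []) ∣)
∣denom-thrice-square∣ u c with denom-thrice-square u c
... | inj₂ eq = trans (cong ∣_∣ eq) (∣3i²∣ (denom (u ++ c ∷ [])))
... | inj₁ eq = trans (cong ∣_∣ eq) (trans (ℤ.∣-i∣≡∣i∣ (+ 3 * (K * K))) (∣3i²∣ K))
  where K = denom (u ++ c ∷ [])

-- Words with admissible digits whose continuant is a power of 3 up to sign.

Digit : ℤ → Set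
Digit b = 3 ≤ ∣ b ∣ × ∣ b ∣ ≤ 8

digit? : Decidable Digit
digit? b = 3 ℕ.≤? ∣ b ∣ ×-dec ∣ b ∣ ℕ.≤? 8

allDigits : ∀ {bs} {_ : True (all? digit? bs)} → All Digit bs
allDigits {bs} {t} = toWitness {a? = all? digit? bs} t

digit-neg : ∀ b → Digit b → Digit (- b)
digit-neg b = subst (λ n → 3 ≤ n × n ≤ 8) (sym (ℤ.∣-i∣≡∣i∣ b))

-- The word meant is 7, `v`, `c`. The field `digitsᶜ` keeps both folds available: squaring replaces
-- `c` by `c + 1` and `c − 1`, while the other fold reuses `c` and `− c`.
record Word (k : ℕ) : Set where
  constructor word
  field
    v       : List ℤ
    c       : ℤ
    digitsᵛ : All Digit v
    digitsᶜ : All Digit (c + 1ℤ ∷ c + -1ℤ ∷ c ∷ [])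
    ∣denom∣ : ∣ denom (+ 7 ∷ v ++ c ∷ []) ∣ ≡ 3 ^ k

-- A folded word ends in the first letter of the half that was reversed; regrouping exposes that
-- letter as the new `c`.
fold-shape : ∀ (b e : ℤ) v m w → (b ∷ v) ++ m ++ reverse (e ∷ w) ≡ b ∷ (v ++ m ++ reverse w) ++ e ∷ []
fold-shape b e v m w = cong (b ∷_) (begin
  v ++ m ++ reverse (e ∷ w)           ≡⟨ cong (λ l → v ++ m ++ l) (unfold-reverse e w) ⟩
  v ++ m ++ reverse w ++ e ∷ []       ≡⟨ cong (v ++_) (++-assoc m (reverse w) _) ⟨
  v ++ (m ++ reverse w) ++ e ∷ []     ≡⟨ ++-assoc v (m ++ reverse w) _ ⟨
  (v ++ m ++ reverse w) ++ e ∷ []     ∎)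
  where open ≡-Reasoning

double : ∀ {k} → Word k → Word (k ℕ.+ k)
double {k} (word v c ds (d₊ ∷ d₋ ∷ d ∷ []) eq) = record
  { v = v ++ (c + 1ℤ ∷ c + -1ℤ ∷ []) ++ reverse v
  ; c = + 7
  ; digitsᵛ = All.++⁺ ds (d₊ ∷ d₋ ∷ All-resp-↭ (↭-sym (↭-reverse v)) ds)
  ; digitsᶜ = allDigits
  ; ∣denom∣ = begin
      ∣ denom (+ 7 ∷ (v ++ (c + 1ℤ ∷ c + -1ℤ ∷ []) ++ reverse v) ++ + 7 ∷ []) ∣
        ≡⟨ cong (λ l → ∣ denom l ∣) (fold-shape (+ 7) (+ 7) v (c + 1ℤ ∷ c + -1ℤ ∷ []) v) ⟨
      ∣ denom ((+ 7 ∷ v) ++ c + 1ℤ ∷ c + -1ℤ ∷ reverse (+ 7 ∷ v)) ∣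
        ≡⟨ ∣denom-square∣ (+ 7 ∷ v) c ⟩
      ∣ denom (+ 7 ∷ v ++ c ∷ []) ∣ ℕ.* ∣ denom (+ 7 ∷ v ++ c ∷ []) ∣
        ≡⟨ cong₂ ℕ._*_ eq eq ⟩
      3 ^ k ℕ.* 3 ^ k
        ≡⟨ ℕ.^-distribˡ-+-* 3 k k ⟨
      3 ^ (k ℕ.+ k) ∎
  }
  where open ≡-Reasoning

suc-double : ∀ {k} → Word k → Word (suc (k ℕ.+ k))
suc-double {k} (word v c ds (d₊ ∷ d₋ ∷ d ∷ []) eq) = record
  { v = v ++ m ++ reverse (map -_ v)
  ; c = - + 7
  ; digitsᵛ = All.++⁺ ds (d ∷ (ℕ.≤-refl , ℕ.m≤m+n 3 5) ∷ digit-neg c d ∷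
                          All-resp-↭ (↭-sym (↭-reverse (map -_ v))) (All.map⁺ (All.map (λ {b} → digit-neg b) ds)))
  ; digitsᶜ = allDigits
  ; ∣denom∣ = begin
      ∣ denom (+ 7 ∷ (v ++ m ++ reverse (map -_ v)) ++ - + 7 ∷ []) ∣
        ≡⟨ cong (λ l → ∣ denom l ∣) (fold-shape (+ 7) (- + 7) v m (map -_ v)) ⟨
      ∣ denom ((+ 7 ∷ v) ++ m ++ reverse (map -_ (+ 7 ∷ v))) ∣
        ≡⟨ ∣denom-thrice-square∣ (+ 7 ∷ v) c ⟩
      3 ℕ.* (∣ denom (+ 7 ∷ v ++ c ∷ []) ∣ ℕ.* ∣ denom (+ 7 ∷ v ++ c ∷ []) ∣)
        ≡⟨ cong (3 ℕ.*_) (cong₂ ℕ._*_ eq eq) ⟩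
      3 ℕ.* (3 ^ k ℕ.* 3 ^ k)
        ≡⟨ cong (3 ℕ.*_) (ℕ.^-distribˡ-+-* 3 k k) ⟨
      3 ^ suc (k ℕ.+ k) ∎
  }
  where
  open ≡-Reasoning
  m = c ∷ + 3 ∷ - c ∷ []

parity : ∀ n → ∃ λ h → n ≡ h ℕ.+ h ⊎ n ≡ suc (h ℕ.+ h)
parity zero = 0 , inj₁ refl
parity (suc n) with parity n
... | h , inj₁ refl = h , inj₂ refl
... | h , inj₂ refl = suc h , inj₁ (cong suc (sym (ℕ.+-suc h h)))

words : ∀ k → Word (3 ℕ.+ k)
words = <-rec (λ k → Word (3 ℕ.+ k)) build
  where
  build : ∀ k → (∀ {i} → i < k → Word (3 ℕ.+ i)) → Word (3 ℕ.+ k)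
  -- The words 7, -4 and 7, 3, -4 and 7, 7, -5 have continuants -27, -81 and -243.
  build 0 _ = word [] (- + 4) [] allDigits refl
  build 1 _ = word (+ 3 ∷ []) (- + 4) allDigits allDigits refl
  build 2 _ = word (+ 7 ∷ []) (- + 5) allDigits allDigits refl
  -- The exponent 6 + k equals 2 (3 + h) or 2 (3 + h) + 1 with h the half of k, and 3 + h is again
  -- an exponent of at least 3.
  build (suc (suc (suc k))) rec with parity k
  ... | h , inj₁ refl =
    subst (λ n → Word (3 ℕ.+ n)) (ℕ.+-comm h (3 ℕ.+ h))
      (double (rec (s≤s (ℕ.m≤n⇒m≤o+n 2 (ℕ.m≤m+n h h)))))
  ... | h , inj₂ refl =
    subst (λ n → Word (4 ℕ.+ n)) (ℕ.+-comm h (3 ℕ.+ h))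
      (suc-double (rec (s≤s (ℕ.m≤n⇒m≤o+n 3 (ℕ.m≤m+n h h)))))

-- Integers inside the rationals, rounding and inversion.

ι : ℤ → ℚ
ι i = i / 1

-- The gcd normalisation in `i / 1` is stuck on a variable `i`; among unnormalised rationals the
-- identities for `ι` become identities between integers.
toℚᵘ-ι : ∀ i → toℚᵘ (ι i) ℚᵘ.≃ mkℚᵘ i 0
toℚᵘ-ι i = ℚ.toℚᵘ-fromℚᵘ (mkℚᵘ i 0)

ι-homo-+ : ∀ i j → ι (i ℤ.+ j) ≡ ι i ℚ.+ ι j
ι-homo-+ i j = ℚ.toℚᵘ-injective (begin
  toℚᵘ (ι (i ℤ.+ j))            ≈⟨ toℚᵘ-ι (i ℤ.+ j) ⟩
  mkℚᵘ (i ℤ.+ j) 0              ≈⟨ *≡* (cong (ℤ._* 1ℤ) (cong₂ ℤ._+_ (ℤ.*-identityʳ i) (ℤ.*-identityʳ j))) ⟨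
  mkℚᵘ i 0 ℚᵘ.+ mkℚᵘ j 0        ≈⟨ ℚᵘ.+-cong (toℚᵘ-ι i) (toℚᵘ-ι j) ⟨
  toℚᵘ (ι i) ℚᵘ.+ toℚᵘ (ι j)    ≈⟨ ℚ.toℚᵘ-homo-+ (ι i) (ι j) ⟨
  toℚᵘ (ι i ℚ.+ ι j)            ∎)
  where open ℚᵘ.≃-Reasoning

ι-homo-* : ∀ i j → ι (i ℤ.* j) ≡ ι i ℚ.* ι j
ι-homo-* i j = ℚ.toℚᵘ-injective (begin
  toℚᵘ (ι (i ℤ.* j))            ≈⟨ toℚᵘ-ι (i ℤ.* j) ⟩
  mkℚᵘ i 0 ℚᵘ.* mkℚᵘ j 0        ≈⟨ ℚᵘ.*-cong (toℚᵘ-ι i) (toℚᵘ-ι j) ⟨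
  toℚᵘ (ι i) ℚᵘ.* toℚᵘ (ι j)    ≈⟨ ℚ.toℚᵘ-homo-* (ι i) (ι j) ⟨
  toℚᵘ (ι i ℚ.* ι j)            ∎)
  where open ℚᵘ.≃-Reasoning

ι-mono-< : ∀ {i j} → i ℤ.< j → ι i ℚ.< ι j
ι-mono-< {i} {j} i<j = ℚ.toℚᵘ-cancel-< (begin-strict
  toℚᵘ (ι i)  ≃⟨ toℚᵘ-ι i ⟩
  mkℚᵘ i 0    <⟨ *<* (subst₂ ℤ._<_ (sym (ℤ.*-identityʳ i)) (sym (ℤ.*-identityʳ j)) i<j) ⟩
  mkℚᵘ j 0    ≃⟨ toℚᵘ-ι j ⟨
  toℚᵘ (ι j)  ∎)
  where open ℚᵘ.≤-Reasoning

ι-≢0 : ∀ i → i ≢ 0ℤ → ι i ≢ 0ℚ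
ι-≢0 i i≢0 eq with ℤ.<-cmp i 0ℤ
... | tri< i<0 _ _ = ℚ.<-irrefl eq (ι-mono-< i<0)
... | tri≈ _ i≡0 _ = i≢0 i≡0
... | tri> _ _ i>0 = ℚ.<-irrefl (sym eq) (ι-mono-< i>0)

/-*-ι : ∀ i n .{{_ : ℕ.NonZero n}} → (i / n) ℚ.* ι (+ n) ≡ ι i
/-*-ι i n@(suc n-1) = ℚ.toℚᵘ-injective (begin
  toℚᵘ ((i / n) ℚ.* ι (+ n))           ≈⟨ ℚ.toℚᵘ-homo-* (i / n) (ι (+ n)) ⟩
  toℚᵘ (i / n) ℚᵘ.* toℚᵘ (ι (+ n))     ≈⟨ ℚᵘ.*-cong (ℚ.toℚᵘ-fromℚᵘ (mkℚᵘ i n-1)) (toℚᵘ-ι (+ n)) ⟩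
  mkℚᵘ i n-1 ℚᵘ.* mkℚᵘ (+ n) 0         ≈⟨ *≡* (ℤ.*-assoc i (+ n) 1ℤ) ⟩
  mkℚᵘ i 0                             ≈⟨ toℚᵘ-ι i ⟨
  toℚᵘ (ι i)                           ∎)
  where open ℚᵘ.≃-Reasoning

-- For x = n / d both b and the quotient f of n by d satisfy b d ≤ n < (b + 1) d and f d ≤ n < (f +
-- 1) d. Combining these crosswise and cancelling d gives f < b + 1 and b < f + 1.
floor-unique : ∀ b x → ι b ℚ.≤ x → x ℚ.< ι (ℤ.suc b) → floor x ≡ b
floor-unique b x@(ℚ.mkℚ n d-1 _) b≤x x<1+b = ℤ.≤-antisym f≤b b≤f
  where
  open ℤ.≤-Reasoning
  d = suc d-1
  f = n ℤ./ℕ d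
  b*d≤n : b ℤ.* + d ℤ.≤ n
  b*d≤n = subst (b ℤ.* + d ℤ.≤_) (ℤ.*-identityʳ n)
    (ℚᵘ.drop-*≤* (ℚᵘ.≤-respˡ-≃ (toℚᵘ-ι b) (ℚ.toℚᵘ-mono-≤ b≤x)))
  n<1+b*d : n ℤ.< ℤ.suc b ℤ.* + d
  n<1+b*d = subst (ℤ._< ℤ.suc b ℤ.* + d) (ℤ.*-identityʳ n)
    (ℚᵘ.drop-*<* (ℚᵘ.<-respʳ-≃ (toℚᵘ-ι (ℤ.suc b)) (ℚ.toℚᵘ-mono-< x<1+b)))
  f≡ : floor x ≡ f
  f≡ = ℤ.div-pos-is-/ℕ n d
  <suc⇒≤ : ∀ {i j} → i ℤ.< ℤ.suc j → i ℤ.≤ j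
  <suc⇒≤ {i} {j} i<1+j = subst (i ℤ.≤_) (ℤ.pred-suc j) (ℤ.i<j⇒i≤pred[j] i<1+j)
  f≤b : floor x ℤ.≤ b
  f≤b rewrite f≡ = <suc⇒≤ (ℤ.*-cancelʳ-<-nonNeg (+ d) (ℤ.≤-<-trans (ℤ.[n/ℕd]*d≤n n d) n<1+b*d))
  b≤f : b ℤ.≤ floor x
  b≤f rewrite f≡ = <suc⇒≤ (ℤ.*-cancelʳ-<-nonNeg (+ d) (ℤ.≤-<-trans b*d≤n (ℤ.n<s[n/ℕd]*d n d)))

ι-mono-≤ : ∀ {i j} → i ℤ.≤ j → ι i ℚ.≤ ι j
ι-mono-≤ {i} {j} i≤j with i ℤ.≟ j
... | yes i≡j = ℚ.≤-reflexive (cong ι i≡j)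
... | no  i≢j = ℚ.<⇒≤ (ι-mono-< (ℤ.≤∧≢⇒< i≤j i≢j))

0≤ι : ∀ n → 0ℚ ℚ.≤ ι (+ n)
0≤ι n = ι-mono-≤ {0ℤ} {+ n} (ℤ.+≤+ z≤n)

∣ι∣ : ∀ i → ℚ.∣ ι i ∣ ≡ ι (+ ∣ i ∣)
∣ι∣ (+ n)      = ℚ.0≤p⇒∣p∣≡p (0≤ι n)
∣ι∣ -[1+ n ]   = trans (ℚ.∣-p∣≡∣p∣ (ι (+ suc n))) (∣ι∣ (+ suc n))

-- Taking absolute values in z q = p gives |z| |q| = |p| < ½ |q|, and |q| cancels.
ratio-small : ∀ z p q → z ℚ.* ι q ≡ ι p → 2 ℕ.* ∣ p ∣ < ∣ q ∣ → ℚ.∣ z ∣ ℚ.< ½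
ratio-small z p q zq≡p 2p<q = ℚ.*-cancelʳ-<-nonNeg (ι (+ ∣ q ∣)) (begin-strict
  ℚ.∣ z ∣ ℚ.* ι (+ ∣ q ∣)       ≡⟨ cong (ℚ.∣ z ∣ ℚ.*_) (∣ι∣ q) ⟨
  ℚ.∣ z ∣ ℚ.* ℚ.∣ ι q ∣         ≡⟨ ℚ.∣p*q∣≡∣p∣*∣q∣ z (ι q) ⟨
  ℚ.∣ z ℚ.* ι q ∣               ≡⟨ cong ℚ.∣_∣ zq≡p ⟩
  ℚ.∣ ι p ∣                     ≡⟨ ∣ι∣ p ⟩
  ι (+ ∣ p ∣)                   ≡⟨ ℚ.*-identityˡ (ι (+ ∣ p ∣)) ⟨
  ½ ℚ.* ι (+ 2) ℚ.* ι (+ ∣ p ∣) ≡⟨ ℚ.*-assoc ½ (ι (+ 2)) (ι (+ ∣ p ∣)) ⟩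
  ½ ℚ.* (ι (+ 2) ℚ.* ι (+ ∣ p ∣)) ≡⟨ cong (½ ℚ.*_) (ι-homo-* (+ 2) (+ ∣ p ∣)) ⟨
  ½ ℚ.* ι (+ 2 ℤ.* + ∣ p ∣)     ≡⟨ cong (λ i → ½ ℚ.* ι i) (ℤ.pos-* 2 ∣ p ∣) ⟨
  ½ ℚ.* ι (+ (2 ℕ.* ∣ p ∣))     <⟨ ℚ.*-monoʳ-<-pos ½ (ι-mono-< {+ (2 ℕ.* ∣ p ∣)} {+ ∣ q ∣} (ℤ.+<+ 2p<q)) ⟩
  ½ ℚ.* ι (+ ∣ q ∣)             ∎)
  where
  open ℚ.≤-Reasoning
  instance
    nonNeg : ℚ.NonNegative (ι (+ ∣ q ∣))
    nonNeg = ℚ.nonNegative (0≤ι ∣ q ∣)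

p≤∣p∣ : ∀ p → p ℚ.≤ ℚ.∣ p ∣
p≤∣p∣ p with ℚ.≤-total 0ℚ p
... | inj₁ 0≤p = ℚ.≤-reflexive (sym (ℚ.0≤p⇒∣p∣≡p 0≤p))
... | inj₂ p≤0 = ℚ.≤-trans p≤0 (ℚ.0≤∣p∣ p)

-- The shift by ½ moves z into the interval from 0 to 1, so rounding b + z to the nearest integer
-- recovers b.
floor-round : ∀ b z → ℚ.∣ z ∣ ℚ.< ½ → floor (ι b ℚ.+ z ℚ.+ ½) ≡ b
floor-round b z ∣z∣<½ = floor-unique b (ι b ℚ.+ z ℚ.+ ½) lower upper
  where
  open ℚ.≤-Reasoning
  -z≤½ : ℚ.- z ℚ.≤ ½
  -z≤½ = begin
    ℚ.- z         ≤⟨ p≤∣p∣ (ℚ.- z) ⟩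
    ℚ.∣ ℚ.- z ∣   ≡⟨ ℚ.∣-p∣≡∣p∣ z ⟩
    ℚ.∣ z ∣       <⟨ ∣z∣<½ ⟩
    ½             ∎
  lower : ι b ℚ.≤ ι b ℚ.+ z ℚ.+ ½
  lower = begin
    ι b                       ≡⟨ ℚ.+-identityʳ (ι b) ⟨
    ι b ℚ.+ 0ℚ                ≡⟨ cong (ι b ℚ.+_) (ℚ.+-inverseʳ z) ⟨
    ι b ℚ.+ (z ℚ.- z)         ≡⟨ ℚ.+-assoc (ι b) z (ℚ.- z) ⟨
    ι b ℚ.+ z ℚ.+ (ℚ.- z)     ≤⟨ ℚ.+-monoʳ-≤ (ι b ℚ.+ z) -z≤½ ⟩
    ι b ℚ.+ z ℚ.+ ½           ∎
  upper : ι b ℚ.+ z ℚ.+ ½ ℚ.< ι (ℤ.suc b)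
  upper = begin-strict
    ι b ℚ.+ z ℚ.+ ½           <⟨ ℚ.+-monoˡ-< ½ (ℚ.+-monoʳ-< (ι b) (ℚ.≤-<-trans (p≤∣p∣ z) ∣z∣<½)) ⟩
    ι b ℚ.+ ½ ℚ.+ ½           ≡⟨ ℚ.+-assoc (ι b) ½ ½ ⟩
    ι b ℚ.+ 1ℚ                ≡⟨ ℚ.+-comm (ι b) 1ℚ ⟩
    1ℚ ℚ.+ ι b                ≡⟨ ι-homo-+ 1ℤ b ⟨
    ι (ℤ.suc b)               ∎

-- Since w² (z² + 0²) = 1, the norm is nonzero, and z divided by it is w. The imaginary part stays
-- 0, so orbits of real points remain real.
inv-real : ∀ z w → w ℚ.* z ≡ 1ℚ → inv (z +i 0ℚ) ≡ just (w +i 0ℚ)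
inv-real z w wz≡1 with (z ℚ.* z ℚ.+ 0ℚ ℚ.* 0ℚ) ℚ.≟ 0ℚ
... | yes zz≡0 = contradiction 1≡0 λ ()
  where
  open ≡-Reasoning
  1≡0 : 1ℚ ≡ 0ℚ
  1≡0 = begin
    1ℚ ℚ.* 1ℚ                                ≡⟨ cong₂ ℚ._*_ wz≡1 wz≡1 ⟨
    (w ℚ.* z) ℚ.* (w ℚ.* z)                  ≡⟨ solve 2 (λ w z → (w :* z) :* (w :* z) := w :* w :* (z :* z :+ con 0ℚ :* con 0ℚ)) refl w z ⟩
    w ℚ.* w ℚ.* (z ℚ.* z ℚ.+ 0ℚ ℚ.* 0ℚ)      ≡⟨ cong (w ℚ.* w ℚ.*_) zz≡0 ⟩
    w ℚ.* w ℚ.* 0ℚ                           ≡⟨ ℚ.*-zeroʳ (w ℚ.* w) ⟩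
    0ℚ                                       ∎
    where open +-*-Solver
... | no zz≢0 = cong just (cong₂ _+i_ zr≡w (cong (ℚ.-_) (ℚ.*-zeroˡ r)))
  where
  open ≡-Reasoning
  instance _ = ℚ.≢-nonZero zz≢0
  n = z ℚ.* z ℚ.+ 0ℚ ℚ.* 0ℚ
  r = ℚ.1/ n
  zr≡w : z ℚ.* r ≡ w
  zr≡w = begin
    z ℚ.* r                   ≡⟨ ℚ.*-identityˡ _ ⟨
    1ℚ ℚ.* (z ℚ.* r)          ≡⟨ cong (ℚ._* (z ℚ.* r)) wz≡1 ⟨
    w ℚ.* z ℚ.* (z ℚ.* r)     ≡⟨ solve 3 (λ w z r → w :* z :* (z :* r) := w :* ((z :* z :+ con 0ℚ :* con 0ℚ) :* r)) refl w z r ⟩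
    w ℚ.* (n ℚ.* r)           ≡⟨ cong (w ℚ.*_) (ℚ.*-inverseʳ n) ⟩
    w ℚ.* 1ℚ                  ≡⟨ ℚ.*-identityʳ w ⟩
    w                         ∎
    where open +-*-Solver

-- The Hurwitz algorithm on real points.

real : ℤ → ℤi
real b = b +iℤ 0ℤ

digits-step : ∀ n {z w} → inv z ≡ just w →
  digits𝔉 (suc n) z ≡ Maybe.map (⌊ w ⌉ ∷_) (digits𝔉 n (w -i toℚi ⌊ w ⌉))
digits-step n eq rewrite eq = refl

-- Here 1 / z = b + z′ rounds to b, so the algorithm emits b and continues with T(z) = z′.
digits-cons : ∀ n b z z′ ds → z ℚ.* (ι b ℚ.+ z′) ≡ 1ℚ → ℚ.∣ z′ ∣ ℚ.< ½ →
  digits𝔉 n (z′ +i 0ℚ) ≡ just ds → digits𝔉 (suc n) (z +i 0ℚ) ≡ just (real b ∷ ds)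
digits-cons n b z z′ ds z*w≡1 ∣z′∣<½ eq = begin
  digits𝔉 (suc n) (z +i 0ℚ)
    ≡⟨ digits-step n (inv-real z w (trans (ℚ.*-comm w z) z*w≡1)) ⟩
  Maybe.map (⌊ w +i 0ℚ ⌉ ∷_) (digits𝔉 n ((w +i 0ℚ) -i toℚi ⌊ w +i 0ℚ ⌉))
    ≡⟨ cong (λ d → Maybe.map (d ∷_) (digits𝔉 n ((w +i 0ℚ) -i toℚi d))) rounded ⟩
  Maybe.map (real b ∷_) (digits𝔉 n ((w ℚ.- ι b) +i 0ℚ))
    ≡⟨ cong (λ x → Maybe.map (real b ∷_) (digits𝔉 n (x +i 0ℚ))) w-b≡z′ ⟩
  Maybe.map (real b ∷_) (digits𝔉 n (z′ +i 0ℚ))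
    ≡⟨ cong (Maybe.map (real b ∷_)) eq ⟩
  just (real b ∷ ds) ∎
  where
  open ≡-Reasoning
  w = ι b ℚ.+ z′
  rounded : ⌊ w +i 0ℚ ⌉ ≡ real b
  rounded = cong (_+iℤ 0ℤ) (floor-round b z′ ∣z′∣<½)
  w-b≡z′ : w ℚ.- ι b ≡ z′
  w-b≡z′ = solve 2 (λ b z → b :+ z :- b := z) refl (ι b) z′
    where open +-*-Solver

Large : ℤ → Set
Large b = 3 ≤ ∣ b ∣

-- By induction |p| < |q| for the tail, so |b q + p| ≥ 3 |q| - |p| > 2 |q|. Hence every tail has a
-- value strictly between -½ and ½, as rounding requires. The proof adds |p| to both sides to avoid
-- subtraction in ℕ.
cont-small : ∀ {bs} → All Large bs → 2 ℕ.* ∣ proj₁ (cont bs) ∣ < ∣ denom bs ∣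
cont-small [] = s≤s z≤n
cont-small {b ∷ bs} (3≤b ∷ ls) = ℕ.+-cancelʳ-< (∣ p ∣) (2 ℕ.* ∣ q ∣) (∣ b ℤ.* q ℤ.+ p ∣) (begin-strict
  2 ℕ.* ∣ q ∣ ℕ.+ ∣ p ∣
    <⟨ ℕ.+-monoʳ-< (2 ℕ.* ∣ q ∣) (ℕ.≤-<-trans (ℕ.m≤m+n ∣ p ∣ _) (cont-small ls)) ⟩
  2 ℕ.* ∣ q ∣ ℕ.+ ∣ q ∣                      ≡⟨ ℕ.+-comm (2 ℕ.* ∣ q ∣) ∣ q ∣ ⟩
  3 ℕ.* ∣ q ∣                                ≤⟨ ℕ.*-monoˡ-≤ ∣ q ∣ 3≤b ⟩
  ∣ b ∣ ℕ.* ∣ q ∣                            ≡⟨ ℤ.abs-* b q ⟨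
  ∣ b ℤ.* q ∣                                ≡⟨ cong ∣_∣ cancel ⟨
  ∣ b ℤ.* q ℤ.+ p ℤ.- p ∣                    ≤⟨ ℤ.∣i-j∣≤∣i∣+∣j∣ (b ℤ.* q ℤ.+ p) p ⟩
  ∣ b ℤ.* q ℤ.+ p ∣ ℕ.+ ∣ p ∣                ∎)
  where
  open ℕ.≤-Reasoning
  p = proj₁ (cont bs)
  q = denom bs
  cancel : b ℤ.* q ℤ.+ p ℤ.- p ≡ b ℤ.* q
  cancel = trans (ℤ.+-assoc (b ℤ.* q) p (ℤ.- p)) (trans (cong (λ x → b ℤ.* q ℤ.+ x) (ℤ.+-inverseʳ p)) (ℤ.+-identityʳ _))

-- With z′ = p / q the value of the tail, the equation z (b q + p) = q says z (b + z′) = 1, which is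
-- one step of the algorithm.
digits-cont : ∀ {bs} → All Large bs → ∀ z → z ℚ.* ι (denom bs) ≡ ι (proj₁ (cont bs)) →
  digits𝔉 (length bs) (z +i 0ℚ) ≡ just (map real bs)
-- The empty word has value 0, where the algorithm stops even with no fuel left; one unit of fuel
-- per digit is thus enough.
digits-cont [] z z*1≡0 rewrite trans (sym (ℚ.*-identityʳ z)) z*1≡0 = refl
digits-cont {b ∷ bs} (_ ∷ ls) z zd≡q =
  digits-cons (length bs) b z z′ (map real bs) zw≡1 (ratio-small z′ p q z′q≡p (cont-small ls))
    (digits-cont ls z′ z′q≡p)
  where
  open ≡-Reasoning
  p = proj₁ (cont bs)
  q = denom bs
  ιq≢0 : ι q ≢ 0ℚ
  ιq≢0 = ι-≢0 q λ q≡0 → ℕ.n≮0 (subst (2 ℕ.* ∣ p ∣ <_) (cong ∣_∣ q≡0) (cont-small ls))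
  instance
    q≢0 : ℚ.NonZero (ι q)
    q≢0 = ℚ.≢-nonZero ιq≢0
  r = ℚ.1/ ι q
  z′ = ι p ℚ.* r
  z′q≡p : z′ ℚ.* ι q ≡ ι p
  z′q≡p = begin
    ι p ℚ.* r ℚ.* ι q     ≡⟨ ℚ.*-assoc (ι p) r (ι q) ⟩
    ι p ℚ.* (r ℚ.* ι q)   ≡⟨ cong (ι p ℚ.*_) (ℚ.*-inverseˡ (ι q)) ⟩
    ι p ℚ.* 1ℚ            ≡⟨ ℚ.*-identityʳ (ι p) ⟩
    ι p                   ∎
  zw≡1 : z ℚ.* (ι b ℚ.+ z′) ≡ 1ℚ
  zw≡1 = begin
    z ℚ.* (ι b ℚ.+ ι p ℚ.* r)
      ≡⟨ cong (λ x → z ℚ.* (x ℚ.+ ι p ℚ.* r)) (ℚ.*-identityʳ (ι b)) ⟨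
    z ℚ.* (ι b ℚ.* 1ℚ ℚ.+ ι p ℚ.* r)
      ≡⟨ cong (λ x → z ℚ.* (ι b ℚ.* x ℚ.+ ι p ℚ.* r)) (ℚ.*-inverseʳ (ι q)) ⟨
    z ℚ.* (ι b ℚ.* (ι q ℚ.* r) ℚ.+ ι p ℚ.* r)
      ≡⟨ solve 5 (λ z b q p r → z :* (b :* (q :* r) :+ p :* r) := z :* (b :* q :+ p) :* r) refl z (ι b) (ι q) (ι p) r ⟩
    z ℚ.* (ι b ℚ.* ι q ℚ.+ ι p) ℚ.* r
      ≡⟨ cong (λ x → z ℚ.* (x ℚ.+ ι p) ℚ.* r) (ι-homo-* b q) ⟨
    z ℚ.* (ι (b ℤ.* q) ℚ.+ ι p) ℚ.* r
      ≡⟨ cong (λ x → z ℚ.* x ℚ.* r) (ι-homo-+ (b ℤ.* q) p) ⟨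
    z ℚ.* ι (b ℤ.* q ℤ.+ p) ℚ.* r
      ≡⟨ cong (ℚ._* r) zd≡q ⟩
    ι q ℚ.* r
      ≡⟨ ℚ.*-inverseʳ (ι q) ⟩
    1ℚ ∎
    where open +-*-Solver

AllAbsLe-real : ∀ {B bs} → All (λ b → ∣ b ∣ ≤ B) bs → AllAbsLe B (map real bs)
AllAbsLe-real [] = _
AllAbsLe-real {B} {b ∷ bs} (b≤B ∷ le) =
  subst (ℤ._≤ + (B ℕ.* B)) (sym (norm b)) (ℤ.+≤+ (ℕ.*-mono-≤ b≤B b≤B)) , AllAbsLe-real le
  where
  square : ∀ i → i ℤ.* i ≡ + (∣ i ∣ ℕ.* ∣ i ∣)
  square (+ n)    = sym (ℤ.pos-* n n)
  square -[1+ n ] = refl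
  norm : ∀ i → normℤi (real i) ≡ + (∣ i ∣ ℕ.* ∣ i ∣)
  norm i = trans (ℤ.+-identityʳ (i ℤ.* i)) (square i)

-- Since |z| < ½, the integer part a₀ is 0 and the expansion of z starts at z itself.
KC≤-real : ∀ {B bs} → All Large bs → All (λ b → ∣ b ∣ ≤ B) bs →
  ∀ z → z ℚ.* ι (denom bs) ≡ ι (proj₁ (cont bs)) → KC≤ (z +i 0ℚ) B
KC≤-real {B} {bs} large le z zq≡p = length bs , map real bs , digits , AllAbsLe-real le
  where
  ∣z∣<½ : ℚ.∣ z ∣ ℚ.< ½
  ∣z∣<½ = ratio-small z (proj₁ (cont bs)) (denom bs) zq≡p (cont-small large)
  floor≡0 : floor (z ℚ.+ ½) ≡ 0ℤ
  floor≡0 = trans (cong (λ x → floor (x ℚ.+ ½)) (sym (ℚ.+-identityˡ z))) (floor-round 0ℤ z ∣z∣<½)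
  digits : hurwitzDigits (length bs) (z +i 0ℚ) ≡ just (map real bs)
  digits = begin
    digits𝔉 (length bs) ((z +i 0ℚ) -i toℚi (real (floor (z ℚ.+ ½))))
      ≡⟨ cong (λ b → digits𝔉 (length bs) ((z +i 0ℚ) -i toℚi (real b))) floor≡0 ⟩
    digits𝔉 (length bs) ((z ℚ.+ 0ℚ) +i 0ℚ)
      ≡⟨ cong (λ x → digits𝔉 (length bs) (x +i 0ℚ)) (ℚ.+-identityʳ z) ⟩
    digits𝔉 (length bs) (z +i 0ℚ)
      ≡⟨ digits-cont large z zq≡p ⟩
    just (map real bs) ∎
    where open ≡-Reasoning

-- Signs, coprimality and the passage to a / 3^k.

7*i+j≥0 : ∀ {i j} → 0ℤ ℤ.≤ i → ∣ j ∣ ≤ ∣ i ∣ → 0ℤ ℤ.≤ + 7 ℤ.* i ℤ.+ j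
7*i+j≥0 {+ m} {+ n} _ _ = subst (λ i → 0ℤ ℤ.≤ i ℤ.+ + n) (ℤ.pos-* 7 m) (ℤ.+≤+ z≤n)
7*i+j≥0 {+ m} { -[1+ n ]} _ n<m = subst (λ i → 0ℤ ℤ.≤ i ℤ.- + suc n) (ℤ.pos-* 7 m)
  (ℤ.i≤j⇒0≤j-i (ℤ.+≤+ (ℕ.≤-trans n<m (ℕ.m≤m+n m _))))

-- For i the continuant and j the numerator of a tail, 7 i + j is the continuant after prefixing the
-- digit 7. The term 7 i dominates, so the whole word has a value i / (7 i + j) that is not
-- negative.
same-sign : ∀ i j → ∣ j ∣ ≤ ∣ i ∣ → let k = + 7 ℤ.* i ℤ.+ j in
  (+ ∣ i ∣ ≡ i × + ∣ k ∣ ≡ k) ⊎ (+ ∣ i ∣ ≡ ℤ.- i × + ∣ k ∣ ≡ ℤ.- k)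
same-sign (+ m) j j≤i = inj₁ (refl , ℤ.0≤i⇒+∣i∣≡i (7*i+j≥0 {+ m} {j} (ℤ.+≤+ z≤n) j≤i))
same-sign i@(-[1+ n ]) j j≤i = inj₂ (refl , trans (cong +_ (sym (ℤ.∣-i∣≡∣i∣ k))) (ℤ.0≤i⇒+∣i∣≡i 0≤-k))
  where
  k = + 7 ℤ.* i ℤ.+ j
  -k≡ : + 7 ℤ.* (ℤ.- i) ℤ.+ (ℤ.- j) ≡ ℤ.- k
  -k≡ = sym (trans (ℤ.neg-distrib-+ (+ 7 ℤ.* i) j) (cong (ℤ._+ (ℤ.- j)) (ℤ.neg-distribʳ-* (+ 7) i)))
  0≤-k : 0ℤ ℤ.≤ ℤ.- k
  0≤-k = subst (0ℤ ℤ.≤_) -k≡ (7*i+j≥0 {ℤ.- i} {ℤ.- j} (ℤ.+≤+ z≤n)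
    (subst (_≤ suc n) (sym (ℤ.∣-i∣≡∣i∣ j)) j≤i))

-- A continuant may be -3^k while the fraction a / 3^k has a positive denominator; if numerator and
-- denominator are both negated, multiplying the equation by -1 reconciles the two.
ratio-abs : ∀ z p q → (+ ∣ p ∣ ≡ p × + ∣ q ∣ ≡ q) ⊎ (+ ∣ p ∣ ≡ ℤ.- p × + ∣ q ∣ ≡ ℤ.- q) →
  z ℚ.* ι (+ ∣ q ∣) ≡ ι (+ ∣ p ∣) → z ℚ.* ι q ≡ ι p
ratio-abs z p q (inj₁ (p≡ , q≡)) eq = subst₂ (λ i j → z ℚ.* ι j ≡ ι i) p≡ q≡ eq
ratio-abs z p q (inj₂ (p≡ , q≡)) eq = begin
  z ℚ.* ι q                     ≡⟨ cong (λ i → z ℚ.* ι i) (via q q≡) ⟩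
  z ℚ.* ι (-1ℤ ℤ.* + ∣ q ∣)   ≡⟨ cong (z ℚ.*_) (ι-homo-* -1ℤ (+ ∣ q ∣)) ⟩
  z ℚ.* (ι -1ℤ ℚ.* ι (+ ∣ q ∣))   ≡⟨ ℚ.*-comm z _ ⟩
  ι -1ℤ ℚ.* ι (+ ∣ q ∣) ℚ.* z     ≡⟨ ℚ.*-assoc (ι -1ℤ) (ι (+ ∣ q ∣)) z ⟩
  ι -1ℤ ℚ.* (ι (+ ∣ q ∣) ℚ.* z)   ≡⟨ cong (ι -1ℤ ℚ.*_) (trans (ℚ.*-comm _ z) eq) ⟩
  ι -1ℤ ℚ.* ι (+ ∣ p ∣)       ≡⟨ ι-homo-* -1ℤ (+ ∣ p ∣) ⟨
  ι (-1ℤ ℤ.* + ∣ p ∣)         ≡⟨ cong ι (via p p≡) ⟨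
  ι p                           ∎
  where
  open ≡-Reasoning
  via : ∀ i → + ∣ i ∣ ≡ ℤ.- i → i ≡ -1ℤ ℤ.* + ∣ i ∣
  via i eq = sym (trans (ℤ.-1*i≡-i _) (trans (cong ℤ.-_ eq) (ℤ.neg-involutive i)))

-- A common divisor of the numerator and 3 divides 3^k because k ≥ 1, hence divides both coordinates
-- of `cont bs`, which are coprime.
gcd-3 : ∀ bs {k} → 1 ≤ k → ∣ denom bs ∣ ≡ 3 ^ k → gcd ∣ proj₁ (cont bs) ∣ 3 ≡ 1
gcd-3 bs {suc k} _ eq = coprime⇒gcd≡1 coprime
  where
  coprime : ∀ {d} → d ℕ∣.∣ ∣ proj₁ (cont bs) ∣ × d ℕ∣.∣ 3 → d ≡ 1
  coprime {d} (d∣p , d∣3) = ℕ∣.∣1⇒≡1 (ℤ∣.∣⇒∣ᵤ (cont-coprime bs {+ d} (ℤ∣.∣ᵤ⇒∣ d∣p) (ℤ∣.∣ᵤ⇒∣ d∣q)))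
    where
    d∣q : d ℕ∣.∣ ∣ denom bs ∣
    d∣q = subst (d ℕ∣.∣_) (sym eq) (ℕ∣.∣m⇒∣m*n (3 ^ k) d∣3)

-- The witness a is |p|, the absolute numerator of the word's value. The bound of `cont-small` for
-- the tail makes it positive, and the one for the whole word makes it less than 3^k.
from-word : ∀ {k} → 1 ≤ k → Word k →
  ∃ λ (a : ℕ) → (1 ≤ a) × (a < 3 ^ k) × (gcd a 3 ≡ 1) × KC≤ ((a /3^ k) +i 0ℚ) 8
from-word {k} 1≤k (word v c ds (_ ∷ _ ∷ d ∷ []) eq) =
  ∣ p ∣ , ℕ.≤-<-trans z≤n small-tail ,
  ℕ.≤-<-trans (ℕ.m≤m+n ∣ p ∣ _) (subst (2 ℕ.* ∣ p ∣ <_) eq (cont-small {+ 7 ∷ bs} large)) ,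
  gcd-3 (+ 7 ∷ bs) 1≤k eq ,
  KC≤-real {bs = + 7 ∷ bs} large (All.map proj₂ digits) z
    (ratio-abs z p (denom (+ 7 ∷ bs)) (same-sign p (proj₁ (cont bs)) (ℕ.<⇒≤ small-tail′)) zq≡p)
  where
  instance _ = ℕ.m^n≢0 3 k
  bs = v ++ c ∷ []
  p = denom bs
  digits : All Digit (+ 7 ∷ bs)
  digits = (ℕ.m≤m+n 3 4 , ℕ.m≤m+n 7 1) ∷ All.++⁺ ds (d ∷ [])
  large : All Large (+ 7 ∷ bs)
  large = All.map proj₁ digits
  small-tail : 2 ℕ.* ∣ proj₁ (cont bs) ∣ < ∣ p ∣
  small-tail = cont-small (All.tail large)
  small-tail′ : ∣ proj₁ (cont bs) ∣ < ∣ p ∣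
  small-tail′ = ℕ.≤-<-trans (ℕ.m≤m+n _ _) small-tail
  z = ∣ p ∣ /3^ k
  zq≡p : z ℚ.* ι (+ ∣ denom (+ 7 ∷ bs) ∣) ≡ ι (+ ∣ p ∣)
  zq≡p = subst (λ n → z ℚ.* ι (+ n) ≡ ι (+ ∣ p ∣)) (sym eq) (/-*-ι (+ ∣ p ∣) (3 ^ k))

theorem5p6 : (k : ℕ) → 1 ≤ k →
    ∃ λ (a : ℕ) → (1 ≤ a) × (a < 3 ^ k) × (gcd a 3 ≡ 1) ×
    KC≤ ((a /3^ k) +i 0ℚ) 8
-- The exponents below 3 are settled by hand, here with 1/3 = 1 / 3.
theorem5p6 1 _ =
  1 , s≤s z≤n , s≤s (s≤s z≤n) , refl , 1 , real (+ 3) ∷ [] , refl , ℤ.+≤+ (ℕ.m≤m+n 9 _) , _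
theorem5p6 2 _ =
  -- Here 2/9 = 1 / (5 + 1 / (-2)): the tie 9/2 is rounded up to 5, leaving -½, which belongs to the
  -- half-open square.
  2 , s≤s z≤n , s≤s (s≤s (s≤s z≤n)) , refl , 2 , real (+ 5) ∷ real (- + 2) ∷ [] , refl ,
  ℤ.+≤+ (ℕ.m≤m+n 25 _) , ℤ.+≤+ (ℕ.m≤m+n 4 _) , _
theorem5p6 (suc (suc (suc k))) 1≤ = from-word 1≤ (words k)
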